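{- Let $\mathscr D$ be a symmetric monoidal duploid, $\mathscr M$ a cartesian category, and let $\mathrm{Lin}:\mathscr M\to\mathscr D$, $\mathrm{Mult}:\mathscr D\rightharpoonup\mathscr M$ form a direct linear-non-linear adjunction, i.e. a positive adjunction such that the functor $\mathscr M\to\mathscr P_t$ induced by $\mathrm{Lin}$ is strong monoidal. Then it induces a $\Downarrow$-relative linear-non-linear coadjunction for $\Downarrow:\mathscr N_l\to\mathscr P_t$: the functors $\mathrm{Lin}:\mathscr M\to\mathscr P_t$ (which is strong monoidal) and $\mathrm{Mult}:\mathscr N_l\to\mathscr M$ (the restriction of $\mathrm{Mult}$) come with bijections $$\mathscr P_t(\mathrm{Lin}X,\Downarrow N)\cong\mathscr M(X,\mathrm{Mult}N)$$ natural in $X\in\mathscr M$ and $N\in\mathscr N_l$.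
   Context: A non-associative category is a category without the associativity axiom. A bare functor $\rightharpoonup$ is a morphism of reflexive graphs (preserves identities, not necessarily composition). A morphism $f$ is thunkable if $(h\circ g)\circ f=h\circ(g\circ f)$ for all composable $g,h$; $h$ is linear if $(h\circ g)\circ f=h\circ(g\circ f)$ for all composable $f,g$. An object is positive if every morphism out of it is linear, negative if every morphism into it is thunkable. An adjunction over non-associative categories $\mathscr D,\mathscr E$: bare functors $F:\mathscr D\rightharpoonup\mathscr E$, $G:\mathscr E\rightharpoonup\mathscr D$ with bijections $\varphi:\mathscr E(FA,B)\cong\mathscr D(A,GB)$ such that $\varphi(g\circ h)=Gg\circ\varphi(h)$ and $\varphi(h\circ Ff)=\varphi(h)\circ f$. It is positive if every $FA$ is positive, negative if every $GB$ is negative. A duploid is a non-associative category $\mathscr D$ in which every object is positive or negative, and in which the identity functor has a left adjoint $\Downarrow:\mathscr D\rightharpoonup\mathscr D$ with positive values and a right adjoint $\Uparrow:\mathscr D\rightharpoonup\mathscr D$ with negative values. $\mathscr P_t$ is the category of positive objects and thunkable morphisms; $\mathscr N_l$ is the category of negative objects and linear morphisms; $\Downarrow$ restricts to a functor $\mathscr N_l\to\mathscr P_t$. The left adjoint of a positive adjunction from a category $\mathscr M$ is a functor corestricting to $\mathscr M\to\mathscr P_t$, and right adjoints restrict to functors on linear maps. A symmetric monoidal duploid is a duploid equipped with a tensor product, which in particular makes $\mathscr P_t$ a symmetric monoidal category; the induced symmetric monoidal structure on $\mathscr P_t$ is the only part of the structure to which the present statement refers. A cartesian category is a category with finite products, viewed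 as a symmetric monoidal category. For a functor $R:\mathscr B\to\mathscr A$ with $\mathscr A$ symmetric monoidal, an $R$-relative linear-non-linear coadjunction consists of a cartesian category $\mathscr M$, a strong monoidal functor $\mathrm{Lin}:\mathscr M\to\mathscr A$, a functor $\mathrm{Mult}:\mathscr B\to\mathscr M$, and bijections $\mathscr A(\mathrm{Lin}X,RB)\cong\mathscr M(X,\mathrm{Mult}B)$ natural in $X$ and $B$. -}

module Defs where

open import Level using (Level; suc; _⊔_)
open import Data.Product using (Σ-syntax; _,_; proj₁; proj₂)
open import Data.Sum using (_⊎_)
open import Function.Bundles using (Inverse)
open import Relation.Binary using (IsEquivalence; Setoid)
import Relation.Binary.Reasoning.Setoid as SetoidReasoning

record NonAssocCategory (o ℓ e : Level) : Set (suc (o ⊔ ℓ ⊔ e)) where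
  infix  4 _≈_ _⇒_
  infixr 9 _∘_
  field
    Obj       : Set o
    _⇒_       : Obj → Obj → Set ℓ
    _≈_       : ∀ {A B} → A ⇒ B → A ⇒ B → Set e
    id        : ∀ {A} → A ⇒ A
    _∘_       : ∀ {A B C} → B ⇒ C → A ⇒ B → A ⇒ C
    equiv     : ∀ {A B} → IsEquivalence (_≈_ {A} {B})
    ∘-resp-≈  : ∀ {A B C} {g g′ : B ⇒ C} {f f′ : A ⇒ B} →
                g ≈ g′ → f ≈ f′ → g ∘ f ≈ g′ ∘ f′
    identityˡ : ∀ {A B} {f : A ⇒ B} → id ∘ f ≈ f
    identityʳ : ∀ {A B} {f : A ⇒ B} → f ∘ id ≈ f

  module Equiv {A B : Obj} = IsEquivalence (equiv {A} {B})

  homSetoid : Obj → Obj → Setoid ℓ e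
  homSetoid A B = record { Carrier = A ⇒ B ; _≈_ = _≈_ ; isEquivalence = equiv }

  module HomReasoning {A B : Obj} = SetoidReasoning (homSetoid A B)

  ∘-resp-≈ˡ : ∀ {A B C} {g g′ : B ⇒ C} {f : A ⇒ B} → g ≈ g′ → g ∘ f ≈ g′ ∘ f
  ∘-resp-≈ˡ p = ∘-resp-≈ p Equiv.refl

  ∘-resp-≈ʳ : ∀ {A B C} {g : B ⇒ C} {f f′ : A ⇒ B} → f ≈ f′ → g ∘ f ≈ g ∘ f′
  ∘-resp-≈ʳ p = ∘-resp-≈ Equiv.refl p

  Thunkable : ∀ {A B} → A ⇒ B → Set (o ⊔ ℓ ⊔ e)
  Thunkable {B = B} f =
    ∀ {C D} (g : B ⇒ C) (h : C ⇒ D) → (h ∘ g) ∘ f ≈ h ∘ (g ∘ f)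

  Linear : ∀ {A B} → A ⇒ B → Set (o ⊔ ℓ ⊔ e)
  Linear {A = A} h =
    ∀ {C D} (f : D ⇒ C) (g : C ⇒ A) → (h ∘ g) ∘ f ≈ h ∘ (g ∘ f)

  Positive : Obj → Set (o ⊔ ℓ ⊔ e)
  Positive A = ∀ {B} (f : A ⇒ B) → Linear f

  Negative : Obj → Set (o ⊔ ℓ ⊔ e)
  Negative B = ∀ {A} (f : A ⇒ B) → Thunkable f

record Category (o ℓ e : Level) : Set (suc (o ⊔ ℓ ⊔ e)) where
  field
    nonAssoc : NonAssocCategory o ℓ e
  open NonAssocCategory nonAssoc public
  field
    assoc : ∀ {A B C D} {f : A ⇒ B} {g : B ⇒ C} {h : C ⇒ D} →
            (h ∘ g) ∘ f ≈ h ∘ (g ∘ f)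

  infix 4 _≅_
  record _≅_ (A B : Obj) : Set (ℓ ⊔ e) where
    field
      from : A ⇒ B
      to   : B ⇒ A
      isoˡ : to ∘ from ≈ id
      isoʳ : from ∘ to ≈ id

𝒫ₜ : ∀ {o ℓ e} → NonAssocCategory o ℓ e → Category (o ⊔ ℓ ⊔ e) (o ⊔ ℓ ⊔ e) e
𝒫ₜ {o} {ℓ} {e} D = record
  { nonAssoc = record
    { Obj       = Σ[ A ∈ Obj ] Positive A
    ; _⇒_       = λ A B → Σ[ f ∈ proj₁ A ⇒ proj₁ B ] Thunkable f
    ; _≈_       = λ f g → proj₁ f ≈ proj₁ g
    ; id        = id , λ g h → trans identityʳ (∘-resp-≈ʳ (sym identityʳ))
    ; _∘_       = λ g f → proj₁ g ∘ proj₁ f , ∘-thunkable (proj₂ g) (proj₂ f)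
    ; equiv     = record { refl = refl ; sym = sym ; trans = trans }
    ; ∘-resp-≈  = ∘-resp-≈
    ; identityˡ = identityˡ
    ; identityʳ = identityʳ
    }
  ; assoc = λ {_} {_} {_} {_} {f} {g} {h} → proj₂ f (proj₁ g) (proj₁ h)
  }
  where
  open NonAssocCategory D
  open Equiv
  ∘-thunkable : ∀ {A B C} {g : B ⇒ C} {f : A ⇒ B} →
                Thunkable g → Thunkable f → Thunkable (g ∘ f)
  ∘-thunkable {g = g} {f} tg tf k h = begin
    (h ∘ k) ∘ (g ∘ f)  ≈⟨ tf g (h ∘ k) ⟨
    ((h ∘ k) ∘ g) ∘ f  ≈⟨ ∘-resp-≈ˡ (tg k h) ⟩
    (h ∘ (k ∘ g)) ∘ f  ≈⟨ tf (k ∘ g) h ⟩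
    h ∘ ((k ∘ g) ∘ f)  ≈⟨ ∘-resp-≈ʳ (tf g k) ⟩
    h ∘ (k ∘ (g ∘ f))  ∎
    where open HomReasoning

𝒩ₗ : ∀ {o ℓ e} → NonAssocCategory o ℓ e → Category (o ⊔ ℓ ⊔ e) (o ⊔ ℓ ⊔ e) e
𝒩ₗ {o} {ℓ} {e} D = record
  { nonAssoc = record
    { Obj       = Σ[ A ∈ Obj ] Negative A
    ; _⇒_       = λ A B → Σ[ f ∈ proj₁ A ⇒ proj₁ B ] Linear f
    ; _≈_       = λ f g → proj₁ f ≈ proj₁ g
    ; id        = id , λ f g → trans (∘-resp-≈ˡ identityˡ) (sym identityˡ)
    ; _∘_       = λ g f → proj₁ g ∘ proj₁ f , ∘-linear (proj₂ g) (proj₂ f)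
    ; equiv     = record { refl = refl ; sym = sym ; trans = trans }
    ; ∘-resp-≈  = ∘-resp-≈
    ; identityˡ = identityˡ
    ; identityʳ = identityʳ
    }
  ; assoc = λ {_} {_} {_} {_} {f} {g} {h} → proj₂ h (proj₁ f) (proj₁ g)
  }
  where
  open NonAssocCategory D
  open Equiv
  ∘-linear : ∀ {A B C} {h : B ⇒ C} {k : A ⇒ B} →
             Linear h → Linear k → Linear (h ∘ k)
  ∘-linear {h = h} {k} lh lk f g = begin
    ((h ∘ k) ∘ g) ∘ f  ≈⟨ ∘-resp-≈ˡ (lh g k) ⟩
    (h ∘ (k ∘ g)) ∘ f  ≈⟨ lh f (k ∘ g) ⟩
    h ∘ ((k ∘ g) ∘ f)  ≈⟨ ∘-resp-≈ʳ (lk f g) ⟩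
    h ∘ (k ∘ (g ∘ f))  ≈⟨ lh (g ∘ f) k ⟨
    (h ∘ k) ∘ (g ∘ f)  ∎
    where open HomReasoning

record BareFunctor {o ℓ e o′ ℓ′ e′ : Level}
    (C : NonAssocCategory o ℓ e) (D : NonAssocCategory o′ ℓ′ e′) :
    Set (o ⊔ ℓ ⊔ e ⊔ o′ ⊔ ℓ′ ⊔ e′) where
  private
    module C = NonAssocCategory C
    module D = NonAssocCategory D
  field
    F₀       : C.Obj → D.Obj
    F₁       : ∀ {A B} → A C.⇒ B → F₀ A D.⇒ F₀ B
    F-resp-≈ : ∀ {A B} {f g : A C.⇒ B} → f C.≈ g → F₁ f D.≈ F₁ g
    identity : ∀ {A} → F₁ (C.id {A}) D.≈ D.id

idBare : ∀ {o ℓ e} (C : NonAssocCategory o ℓ e) → BareFunctor C C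
idBare C = record
  { F₀ = λ A → A ; F₁ = λ f → f ; F-resp-≈ = λ p → p ; identity = Equiv.refl }
  where open NonAssocCategory C

record Functor {o ℓ e o′ ℓ′ e′ : Level}
    (C : Category o ℓ e) (D : Category o′ ℓ′ e′) :
    Set (o ⊔ ℓ ⊔ e ⊔ o′ ⊔ ℓ′ ⊔ e′) where
  private
    module C = Category C
    module D = Category D
  field
    bare : BareFunctor C.nonAssoc D.nonAssoc
  open BareFunctor bare public
  field
    homomorphism : ∀ {A B X} {f : A C.⇒ B} {g : B C.⇒ X} →
                   F₁ (g C.∘ f) D.≈ F₁ g D.∘ F₁ f

record Adjunction {o ℓ e o′ ℓ′ e′ : Level}
    {D : NonAssocCategory o ℓ e} {E : NonAssocCategory o′ ℓ′ e′}
    (F : BareFunctor D E) (G : BareFunctor E D) :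
    Set (o ⊔ ℓ ⊔ e ⊔ o′ ⊔ ℓ′ ⊔ e′) where
  private
    module D = NonAssocCategory D
    module E = NonAssocCategory E
    module F = BareFunctor F
    module G = BareFunctor G
  field
    φ : ∀ {A B} → Inverse (E.homSetoid (F.F₀ A) B) (D.homSetoid A (G.F₀ B))
  module φ {A} {B} = Inverse (φ {A} {B})
  field
    φ-naturalˡ : ∀ {A B B′} (g : B E.⇒ B′) (h : F.F₀ A E.⇒ B) →
                 φ.to (g E.∘ h) D.≈ G.F₁ g D.∘ φ.to h
    φ-naturalʳ : ∀ {A A′ B} (h : F.F₀ A E.⇒ B) (f : A′ D.⇒ A) →
                 φ.to (h E.∘ F.F₁ f) D.≈ φ.to h D.∘ f

  IsPositive : Set (o ⊔ o′ ⊔ ℓ′ ⊔ e′)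
  IsPositive = ∀ A → E.Positive (F.F₀ A)

  IsNegative : Set (o ⊔ ℓ ⊔ e ⊔ o′)
  IsNegative = ∀ B → D.Negative (G.F₀ B)

  φ-injective : ∀ {A B} {h k : F.F₀ A E.⇒ B} → φ.to h D.≈ φ.to k → h E.≈ k
  φ-injective {h = h} {k} p = begin
    h                   ≈⟨ φ.strictlyInverseʳ h ⟨
    φ.from (φ.to h)     ≈⟨ φ.from-cong p ⟩
    φ.from (φ.to k)     ≈⟨ φ.strictlyInverseʳ k ⟩
    k                   ∎
    where open E.HomReasoning

  φ∘F₁ : ∀ {A A′} (f : A′ D.⇒ A) → φ.to (F.F₁ f) D.≈ φ.to E.id D.∘ f
  φ∘F₁ f = begin
    φ.to (F.F₁ f)           ≈⟨ φ.to-cong E.identityˡ ⟨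
    φ.to (E.id E.∘ F.F₁ f)  ≈⟨ φ-naturalʳ E.id f ⟩
    φ.to E.id D.∘ f         ∎
    where open D.HomReasoning

  F₁-thunkable : ∀ {A A′} (f : A′ D.⇒ A) → D.Thunkable f → E.Thunkable (F.F₁ f)
  F₁-thunkable f tf g h = φ-injective (begin
    φ.to ((h E.∘ g) E.∘ F.F₁ f)      ≈⟨ φ-naturalʳ (h E.∘ g) f ⟩
    φ.to (h E.∘ g) D.∘ f             ≈⟨ D.∘-resp-≈ˡ (φ-naturalˡ h g) ⟩
    (G.F₁ h D.∘ φ.to g) D.∘ f        ≈⟨ tf (φ.to g) (G.F₁ h) ⟩
    G.F₁ h D.∘ (φ.to g D.∘ f)        ≈⟨ D.∘-resp-≈ʳ (φ-naturalʳ g f) ⟨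
    G.F₁ h D.∘ φ.to (g E.∘ F.F₁ f)   ≈⟨ φ-naturalˡ h (g E.∘ F.F₁ f) ⟨
    φ.to (h E.∘ (g E.∘ F.F₁ f))      ∎)
    where open D.HomReasoning

  F-∘ : ∀ {A B C} (g : B D.⇒ C) (f : A D.⇒ B) → D.Thunkable f →
        F.F₁ (g D.∘ f) E.≈ F.F₁ g E.∘ F.F₁ f
  F-∘ g f tf = φ-injective (begin
    φ.to (F.F₁ (g D.∘ f))         ≈⟨ φ∘F₁ (g D.∘ f) ⟩
    φ.to E.id D.∘ (g D.∘ f)       ≈⟨ tf g (φ.to E.id) ⟨
    (φ.to E.id D.∘ g) D.∘ f       ≈⟨ D.∘-resp-≈ˡ (φ∘F₁ g) ⟨
    φ.to (F.F₁ g) D.∘ f           ≈⟨ φ-naturalʳ (F.F₁ g) f ⟨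
    φ.to (F.F₁ g E.∘ F.F₁ f)      ∎)
    where open D.HomReasoning

  G₁≈ : ∀ {B B′} (g : B E.⇒ B′) → G.F₁ g D.≈ φ.to (g E.∘ φ.from D.id)
  G₁≈ g = begin
    G.F₁ g                           ≈⟨ D.identityʳ ⟨
    G.F₁ g D.∘ D.id                  ≈⟨ D.∘-resp-≈ʳ (φ.strictlyInverseˡ D.id) ⟨
    G.F₁ g D.∘ φ.to (φ.from D.id)    ≈⟨ φ-naturalˡ g (φ.from D.id) ⟨
    φ.to (g E.∘ φ.from D.id)         ∎
    where open D.HomReasoning

  G-∘ : ∀ {A B C} (g : B E.⇒ C) (f : A E.⇒ B) → E.Linear g →
        G.F₁ (g E.∘ f) D.≈ G.F₁ g D.∘ G.F₁ f
  G-∘ g f lg = begin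
    G.F₁ (g E.∘ f)                        ≈⟨ G₁≈ (g E.∘ f) ⟩
    φ.to ((g E.∘ f) E.∘ φ.from D.id)      ≈⟨ φ.to-cong (lg (φ.from D.id) f) ⟩
    φ.to (g E.∘ (f E.∘ φ.from D.id))      ≈⟨ φ-naturalˡ g (f E.∘ φ.from D.id) ⟩
    G.F₁ g D.∘ φ.to (f E.∘ φ.from D.id)   ≈⟨ D.∘-resp-≈ʳ (G₁≈ f) ⟨
    G.F₁ g D.∘ G.F₁ f                     ∎
    where open D.HomReasoning

module _ {o ℓ e o′ ℓ′ e′ : Level}
    (C : Category o ℓ e) {E : NonAssocCategory o′ ℓ′ e′} where

  private
    module C = Category C
    module E = NonAssocCategory E

  corestrictˡ : {F : BareFunctor C.nonAssoc E} {G : BareFunctor E C.nonAssoc} →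
                (adj : Adjunction F G) → Adjunction.IsPositive adj →
                Functor C (𝒫ₜ E)
  corestrictˡ {F} adj pos = record
    { bare = record
      { F₀       = λ A → F₀ A , pos A
      ; F₁       = λ f → F₁ f , F₁-thunkable f (λ _ _ → C.assoc)
      ; F-resp-≈ = F-resp-≈
      ; identity = identity
      }
    ; homomorphism = λ {_} {_} {_} {f} {g} → F-∘ g f (λ _ _ → C.assoc)
    }
    where
    open BareFunctor F
    open Adjunction adj

  restrictʳ : {F : BareFunctor C.nonAssoc E} {G : BareFunctor E C.nonAssoc} →
              Adjunction F G → Functor (𝒩ₗ E) C
  restrictʳ {G = G} adj = record
    { bare = record
      { F₀       = λ N → F₀ (proj₁ N)
      ; F₁       = λ f → F₁ (proj₁ f)
      ; F-resp-≈ = F-resp-≈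
      ; identity = identity
      }
    ; homomorphism = λ {_} {_} {_} {f} {g} →
        Adjunction.G-∘ adj (proj₁ g) (proj₁ f) (proj₂ g)
    }
    where open BareFunctor G

record SymmetricMonoidal {o ℓ e : Level} (C : Category o ℓ e) : Set (o ⊔ ℓ ⊔ e) where
  open Category C
  infixr 10 _⊗₀_ _⊗₁_
  field
    unit       : Obj
    _⊗₀_       : Obj → Obj → Obj
    _⊗₁_       : ∀ {A A′ B B′} → A ⇒ A′ → B ⇒ B′ → A ⊗₀ B ⇒ A′ ⊗₀ B′
    ⊗-resp-≈   : ∀ {A A′ B B′} {f f′ : A ⇒ A′} {g g′ : B ⇒ B′} →
                 f ≈ f′ → g ≈ g′ → f ⊗₁ g ≈ f′ ⊗₁ g′
    ⊗-identity : ∀ {A B} → id {A} ⊗₁ id {B} ≈ id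
    ⊗-∘        : ∀ {A A′ A″ B B′ B″} {f : A ⇒ A′} {f′ : A′ ⇒ A″}
                   {g : B ⇒ B′} {g′ : B′ ⇒ B″} →
                 (f′ ∘ f) ⊗₁ (g′ ∘ g) ≈ (f′ ⊗₁ g′) ∘ (f ⊗₁ g)

    associator : ∀ {A B C} → (A ⊗₀ B) ⊗₀ C ≅ A ⊗₀ (B ⊗₀ C)
    unitorˡ    : ∀ {A} → unit ⊗₀ A ≅ A
    unitorʳ    : ∀ {A} → A ⊗₀ unit ≅ A
    braiding   : ∀ {A B} → A ⊗₀ B ⇒ B ⊗₀ A

  α : ∀ {A B C} → (A ⊗₀ B) ⊗₀ C ⇒ A ⊗₀ (B ⊗₀ C)
  α = _≅_.from associator
  λ⇒ : ∀ {A} → unit ⊗₀ A ⇒ A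
  λ⇒ = _≅_.from unitorˡ
  ρ⇒ : ∀ {A} → A ⊗₀ unit ⇒ A
  ρ⇒ = _≅_.from unitorʳ

  field
    α-natural : ∀ {A A′ B B′ C C′} {f : A ⇒ A′} {g : B ⇒ B′} {h : C ⇒ C′} →
                α ∘ ((f ⊗₁ g) ⊗₁ h) ≈ (f ⊗₁ (g ⊗₁ h)) ∘ α
    λ-natural : ∀ {A B} {f : A ⇒ B} → λ⇒ ∘ (id ⊗₁ f) ≈ f ∘ λ⇒
    ρ-natural : ∀ {A B} {f : A ⇒ B} → ρ⇒ ∘ (f ⊗₁ id) ≈ f ∘ ρ⇒
    σ-natural : ∀ {A A′ B B′} {f : A ⇒ A′} {g : B ⇒ B′} →
                braiding ∘ (f ⊗₁ g) ≈ (g ⊗₁ f) ∘ braiding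

    triangle  : ∀ {A B} → (id {A} ⊗₁ λ⇒ {B}) ∘ α ≈ ρ⇒ ⊗₁ id
    pentagon  : ∀ {A B C D} →
                (id {A} ⊗₁ α {B} {C} {D}) ∘ (α ∘ (α ⊗₁ id)) ≈ α ∘ α
    hexagon   : ∀ {A B C} →
                (id {B} ⊗₁ braiding {A} {C}) ∘ (α ∘ (braiding ⊗₁ id)) ≈
                α ∘ (braiding ∘ α)
    symmetry  : ∀ {A B} → braiding ∘ braiding ≈ id {A ⊗₀ B}

record SymmetricMonoidalCategory (o ℓ e : Level) : Set (suc (o ⊔ ℓ ⊔ e)) where
  field
    category          : Category o ℓ e
    symmetricMonoidal : SymmetricMonoidal category
  open Category category public
  open SymmetricMonoidal symmetricMonoidal public

record StrongMonoidal {o ℓ e o′ ℓ′ e′ : Level}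
    (C : SymmetricMonoidalCategory o ℓ e) (D : SymmetricMonoidalCategory o′ ℓ′ e′)
    (F : Functor (SymmetricMonoidalCategory.category C)
                 (SymmetricMonoidalCategory.category D)) :
    Set (o ⊔ ℓ ⊔ e ⊔ o′ ⊔ ℓ′ ⊔ e′) where
  private
    module C = SymmetricMonoidalCategory C
    module D = SymmetricMonoidalCategory D
  open Functor F
  open D using (_∘_; _≈_; _≅_; _⊗₀_; _⊗₁_)
  field
    ε-iso : D.unit ≅ F₀ C.unit
    μ-iso : ∀ {A B} → F₀ A ⊗₀ F₀ B ≅ F₀ (A C.⊗₀ B)

  ε : D.unit D.⇒ F₀ C.unit
  ε = _≅_.from ε-iso
  μ : ∀ {A B} → F₀ A ⊗₀ F₀ B D.⇒ F₀ (A C.⊗₀ B)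
  μ = _≅_.from μ-iso

  field
    μ-natural     : ∀ {A A′ B B′} {f : A C.⇒ A′} {g : B C.⇒ B′} →
                    μ ∘ (F₁ f ⊗₁ F₁ g) ≈ F₁ (f C.⊗₁ g) ∘ μ
    associativity : ∀ {A B X} →
                    F₁ (C.α {A} {B} {X}) ∘ (μ ∘ (μ ⊗₁ D.id)) ≈
                    μ ∘ ((D.id ⊗₁ μ) ∘ D.α)
    unitaryˡ      : ∀ {A} → F₁ (C.λ⇒ {A}) ∘ (μ ∘ (ε ⊗₁ D.id)) ≈ D.λ⇒
    unitaryʳ      : ∀ {A} → F₁ (C.ρ⇒ {A}) ∘ (μ ∘ (D.id ⊗₁ ε)) ≈ D.ρ⇒

record StrongMonoidalFunctor {o ℓ e o′ ℓ′ e′ : Level}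
    (C : SymmetricMonoidalCategory o ℓ e) (D : SymmetricMonoidalCategory o′ ℓ′ e′) :
    Set (o ⊔ ℓ ⊔ e ⊔ o′ ⊔ ℓ′ ⊔ e′) where
  field
    functor        : Functor (SymmetricMonoidalCategory.category C)
                             (SymmetricMonoidalCategory.category D)
    strongMonoidal : StrongMonoidal C D functor
  open Functor functor public
  open StrongMonoidal strongMonoidal public

record CartesianCategory (o ℓ e : Level) : Set (suc (o ⊔ ℓ ⊔ e)) where
  field
    category : Category o ℓ e
  open Category category public
  infixr 7 _×_
  field
    ⊤        : Obj
    !        : ∀ {A} → A ⇒ ⊤
    !-unique : ∀ {A} (f : A ⇒ ⊤) → ! ≈ f
    _×_      : Obj → Obj → Obj
    π₁       : ∀ {A B} → A × B ⇒ A
    π₂       : ∀ {A B} → A × B ⇒ B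
    ⟨_,_⟩    : ∀ {A B X} → X ⇒ A → X ⇒ B → X ⇒ A × B
    project₁ : ∀ {A B X} {f : X ⇒ A} {g : X ⇒ B} → π₁ ∘ ⟨ f , g ⟩ ≈ f
    project₂ : ∀ {A B X} {f : X ⇒ A} {g : X ⇒ B} → π₂ ∘ ⟨ f , g ⟩ ≈ g
    unique   : ∀ {A B X} {f : X ⇒ A} {g : X ⇒ B} {h : X ⇒ A × B} →
               π₁ ∘ h ≈ f → π₂ ∘ h ≈ g → ⟨ f , g ⟩ ≈ h

  open Equiv

  private
    variable
      A B C D X Y : Obj

    infixr 10 _×₁_
    _×₁_ : ∀ {A A′ B B′} → A ⇒ A′ → B ⇒ B′ → A × B ⇒ A′ × B′
    f ×₁ g = ⟨ f ∘ π₁ , g ∘ π₂ ⟩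

    ⟨⟩-cong : {f f′ : X ⇒ A} {g g′ : X ⇒ B} → f ≈ f′ → g ≈ g′ →
              ⟨ f , g ⟩ ≈ ⟨ f′ , g′ ⟩
    ⟨⟩-cong p q = unique (trans project₁ (sym p)) (trans project₂ (sym q))

    ⟨⟩∘ : {f : X ⇒ A} {g : X ⇒ B} {h : Y ⇒ X} →
          ⟨ f , g ⟩ ∘ h ≈ ⟨ f ∘ h , g ∘ h ⟩
    ⟨⟩∘ = sym (unique (trans (sym assoc) (∘-resp-≈ˡ project₁))
                      (trans (sym assoc) (∘-resp-≈ˡ project₂)))

    ⟨π₁,π₂⟩ : ⟨ π₁ , π₂ ⟩ ≈ id {A × B}
    ⟨π₁,π₂⟩ = unique identityʳ identityʳ

    ×₁∘⟨⟩ : ∀ {A A′ B B′} {f : A ⇒ A′} {g : B ⇒ B′} {h : X ⇒ A} {k : X ⇒ B} →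
            (f ×₁ g) ∘ ⟨ h , k ⟩ ≈ ⟨ f ∘ h , g ∘ k ⟩
    ×₁∘⟨⟩ = trans ⟨⟩∘ (⟨⟩-cong (trans assoc (∘-resp-≈ʳ project₁))
                               (trans assoc (∘-resp-≈ʳ project₂)))

    α⇒ : (A × B) × C ⇒ A × (B × C)
    α⇒ = ⟨ π₁ ∘ π₁ , ⟨ π₂ ∘ π₁ , π₂ ⟩ ⟩

    α⇐ : A × (B × C) ⇒ (A × B) × C
    α⇐ = ⟨ ⟨ π₁ , π₁ ∘ π₂ ⟩ , π₂ ∘ π₂ ⟩

    σ : A × B ⇒ B × A
    σ = ⟨ π₂ , π₁ ⟩

    π∘π∘⟨⟩ : ∀ {f : A ⇒ B} {g : C ⇒ A} {h : X ⇒ C} {k l} →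
             g ∘ h ≈ k → f ∘ k ≈ l → (f ∘ g) ∘ h ≈ l
    π∘π∘⟨⟩ p q = trans assoc (trans (∘-resp-≈ʳ p) q)

    α⇒∘ : {a : X ⇒ A} {b : X ⇒ B} {c : X ⇒ C} →
          α⇒ ∘ ⟨ ⟨ a , b ⟩ , c ⟩ ≈ ⟨ a , ⟨ b , c ⟩ ⟩
    α⇒∘ = trans ⟨⟩∘ (⟨⟩-cong (π∘π∘⟨⟩ project₁ project₁)
            (trans ⟨⟩∘ (⟨⟩-cong (π∘π∘⟨⟩ project₁ project₂) project₂)))

    α⇐∘ : {a : X ⇒ A} {b : X ⇒ B} {c : X ⇒ C} →
          α⇐ ∘ ⟨ a , ⟨ b , c ⟩ ⟩ ≈ ⟨ ⟨ a , b ⟩ , c ⟩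
    α⇐∘ = trans ⟨⟩∘ (⟨⟩-cong
            (trans ⟨⟩∘ (⟨⟩-cong project₁ (π∘π∘⟨⟩ project₂ project₁)))
            (π∘π∘⟨⟩ project₂ project₂))

    σ∘ : {a : X ⇒ A} {b : X ⇒ B} → σ ∘ ⟨ a , b ⟩ ≈ ⟨ b , a ⟩
    σ∘ = trans ⟨⟩∘ (⟨⟩-cong project₂ project₁)

    η : (h : X ⇒ A × B) → h ≈ ⟨ π₁ ∘ h , π₂ ∘ h ⟩
    η h = sym (unique refl refl)

    -- Generalised elements: to compare maps out of a product it suffices to
    -- compare them on tuples.
    ext₂ : {f g : A × B ⇒ X} →
           (∀ {Y} (a : Y ⇒ A) (b : Y ⇒ B) → f ∘ ⟨ a , b ⟩ ≈ g ∘ ⟨ a , b ⟩) → f ≈ g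
    ext₂ {f = f} {g} p = begin
      f                  ≈⟨ identityʳ ⟨
      f ∘ id             ≈⟨ ∘-resp-≈ʳ ⟨π₁,π₂⟩ ⟨
      f ∘ ⟨ π₁ , π₂ ⟩    ≈⟨ p π₁ π₂ ⟩
      g ∘ ⟨ π₁ , π₂ ⟩    ≈⟨ ∘-resp-≈ʳ ⟨π₁,π₂⟩ ⟩
      g ∘ id             ≈⟨ identityʳ ⟩
      g                  ∎
      where open HomReasoning

    along : {f g : A ⇒ B} {x y : X ⇒ A} → x ≈ y → f ∘ y ≈ g ∘ y → f ∘ x ≈ g ∘ x
    along p q = trans (∘-resp-≈ʳ p) (trans q (∘-resp-≈ʳ (sym p)))

    ext₃ : {f g : (A × B) × C ⇒ X} →
           (∀ {Y} (a : Y ⇒ A) (b : Y ⇒ B) (c : Y ⇒ C) →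
             f ∘ ⟨ ⟨ a , b ⟩ , c ⟩ ≈ g ∘ ⟨ ⟨ a , b ⟩ , c ⟩) → f ≈ g
    ext₃ p = ext₂ λ ab c → along (⟨⟩-cong (η ab) refl) (p _ _ c)

    ext₃′ : {f g : A × (B × C) ⇒ X} →
            (∀ {Y} (a : Y ⇒ A) (b : Y ⇒ B) (c : Y ⇒ C) →
              f ∘ ⟨ a , ⟨ b , c ⟩ ⟩ ≈ g ∘ ⟨ a , ⟨ b , c ⟩ ⟩) → f ≈ g
    ext₃′ p = ext₂ λ a bc → along (⟨⟩-cong refl (η bc)) (p a _ _)

    ext₄ : {f g : ((A × B) × C) × D ⇒ X} →
           (∀ {Y} (a : Y ⇒ A) (b : Y ⇒ B) (c : Y ⇒ C) (d : Y ⇒ D) →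
             f ∘ ⟨ ⟨ ⟨ a , b ⟩ , c ⟩ , d ⟩ ≈ g ∘ ⟨ ⟨ ⟨ a , b ⟩ , c ⟩ , d ⟩) → f ≈ g
    ext₄ p = ext₃ λ ab c d → along (⟨⟩-cong (⟨⟩-cong (η ab) refl) refl) (p _ _ c d)

    infixr 5 _▸_
    _▸_ : {f : B ⇒ C} {g : A ⇒ B} {x : X ⇒ A} {y : X ⇒ B} {z : X ⇒ C} →
          g ∘ x ≈ y → f ∘ y ≈ z → (f ∘ g) ∘ x ≈ z
    p ▸ q = π∘π∘⟨⟩ p q

    infix 4 _≈≈_
    _≈≈_ : {x y z : A ⇒ B} → x ≈ z → y ≈ z → x ≈ y
    p ≈≈ q = trans p (sym q)

    !-unique₂ : (f g : A ⇒ ⊤) → f ≈ g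
    !-unique₂ f g = trans (sym (!-unique f)) (!-unique g)

  cartesianMonoidal : SymmetricMonoidal category
  cartesianMonoidal = record
    { unit       = ⊤
    ; _⊗₀_       = _×_
    ; _⊗₁_       = _×₁_
    ; ⊗-resp-≈   = λ p q → ⟨⟩-cong (∘-resp-≈ˡ p) (∘-resp-≈ˡ q)
    ; ⊗-identity = trans (⟨⟩-cong identityˡ identityˡ) ⟨π₁,π₂⟩
    ; ⊗-∘        = sym (trans ×₁∘⟨⟩ (⟨⟩-cong (sym assoc) (sym assoc)))
    ; associator = record
      { from = α⇒
      ; to   = α⇐
      ; isoˡ = ext₃ λ a b c → (α⇒∘ ▸ α⇐∘) ≈≈ identityˡ
      ; isoʳ = ext₃′ λ a b c → (α⇐∘ ▸ α⇒∘) ≈≈ identityˡ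
      }
    ; unitorˡ    = record
      { from = π₂
      ; to   = ⟨ ! , id ⟩
      ; isoˡ = ext₂ λ a b → (project₂ ▸ trans ⟨⟩∘ (⟨⟩-cong (!-unique₂ _ _) identityˡ))
                            ≈≈ identityˡ
      ; isoʳ = project₂
      }
    ; unitorʳ    = record
      { from = π₁
      ; to   = ⟨ id , ! ⟩
      ; isoˡ = ext₂ λ a b → (project₁ ▸ trans ⟨⟩∘ (⟨⟩-cong identityˡ (!-unique₂ _ _)))
                            ≈≈ identityˡ
      ; isoʳ = project₁
      }
    ; braiding   = σ
    ; α-natural  = ext₃ λ a b c →
        (trans ×₁∘⟨⟩ (⟨⟩-cong ×₁∘⟨⟩ refl) ▸ α⇒∘)
        ≈≈ (α⇒∘ ▸ trans ×₁∘⟨⟩ (⟨⟩-cong refl ×₁∘⟨⟩))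
    ; λ-natural  = project₂
    ; ρ-natural  = project₁
    ; σ-natural  = ext₂ λ a b → (×₁∘⟨⟩ ▸ σ∘) ≈≈ (σ∘ ▸ ×₁∘⟨⟩)
    ; triangle   = ext₃ λ a b c →
        (α⇒∘ ▸ trans ×₁∘⟨⟩ (⟨⟩-cong identityˡ project₂))
        ≈≈ trans ×₁∘⟨⟩ (⟨⟩-cong project₁ identityˡ)
    ; pentagon   = ext₄ λ a b c d →
        ((trans ×₁∘⟨⟩ (⟨⟩-cong α⇒∘ identityˡ) ▸ α⇒∘)
          ▸ trans ×₁∘⟨⟩ (⟨⟩-cong identityˡ α⇒∘))
        ≈≈ (α⇒∘ ▸ α⇒∘)
    ; hexagon    = ext₃ λ a b c →
        ((trans ×₁∘⟨⟩ (⟨⟩-cong σ∘ identityˡ) ▸ α⇒∘)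
          ▸ trans ×₁∘⟨⟩ (⟨⟩-cong identityˡ σ∘))
        ≈≈ ((α⇒∘ ▸ σ∘) ▸ α⇒∘)
    ; symmetry   = ext₂ λ a b → (σ∘ ▸ σ∘) ≈≈ identityˡ
    }

  symmetricMonoidalCategory : SymmetricMonoidalCategory o ℓ e
  symmetricMonoidalCategory = record
    { category = category ; symmetricMonoidal = cartesianMonoidal }

record Duploid (o ℓ e : Level) : Set (suc (o ⊔ ℓ ⊔ e)) where
  field
    nonAssoc  : NonAssocCategory o ℓ e
  open NonAssocCategory nonAssoc public
  field
    polarised  : ∀ A → Positive A ⊎ Negative A
    ⇓          : BareFunctor nonAssoc nonAssoc
    ⇓⊣id       : Adjunction ⇓ (idBare nonAssoc)
    ⇓-positive : Adjunction.IsPositive ⇓⊣id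
    ⇑          : BareFunctor nonAssoc nonAssoc
    id⊣⇑       : Adjunction (idBare nonAssoc) ⇑
    ⇑-negative : Adjunction.IsNegative id⊣⇑

  ⇓ₙ : Functor (𝒩ₗ nonAssoc) (𝒫ₜ nonAssoc)
  ⇓ₙ = record
    { bare = record
      { F₀       = λ N → F₀ (proj₁ N) , ⇓-positive (proj₁ N)
      ; F₁       = λ {_} {N} f → F₁ (proj₁ f) , F₁-thunkable (proj₁ f) (proj₂ N (proj₁ f))
      ; F-resp-≈ = F-resp-≈
      ; identity = identity
      }
    ; homomorphism = λ {_} {N} {_} {f} {g} →
        F-∘ (proj₁ g) (proj₁ f) (proj₂ N (proj₁ f))
    }
    where
    open BareFunctor ⇓
    open Adjunction ⇓⊣id

-- Of the tensor product, only the symmetric monoidal structure it induces on 𝒫ₜ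
-- is recorded.  This asks for less than a tensor product on the whole duploid,
-- so a theorem about this record applies to every symmetric monoidal duploid.
record SymmetricMonoidalDuploid (o ℓ e : Level) : Set (suc (o ⊔ ℓ ⊔ e)) where
  field
    duploid              : Duploid o ℓ e
  open Duploid duploid public
  field
    𝒫ₜ-symmetricMonoidal : SymmetricMonoidal (𝒫ₜ nonAssoc)

  𝒫ₜ-category : SymmetricMonoidalCategory (o ⊔ ℓ ⊔ e) (o ⊔ ℓ ⊔ e) e
  𝒫ₜ-category = record
    { category = 𝒫ₜ nonAssoc ; symmetricMonoidal = 𝒫ₜ-symmetricMonoidal }

  𝒩ₗ-category : Category (o ⊔ ℓ ⊔ e) (o ⊔ ℓ ⊔ e) e
  𝒩ₗ-category = 𝒩ₗ nonAssoc

record DirectLNLAdjunction {o ℓ e o′ ℓ′ e′ : Level}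
    (D : SymmetricMonoidalDuploid o ℓ e) (M : CartesianCategory o′ ℓ′ e′) :
    Set (o ⊔ ℓ ⊔ e ⊔ o′ ⊔ ℓ′ ⊔ e′) where
  private
    module D = SymmetricMonoidalDuploid D
    module M = CartesianCategory M
  field
    Lin      : BareFunctor M.nonAssoc D.nonAssoc
    Mult     : BareFunctor D.nonAssoc M.nonAssoc
    Lin⊣Mult : Adjunction Lin Mult
    positive : Adjunction.IsPositive Lin⊣Mult

  Linₜ : Functor M.category (𝒫ₜ D.nonAssoc)
  Linₜ = corestrictˡ M.category Lin⊣Mult positive

  Multₗ : Functor (𝒩ₗ D.nonAssoc) M.category
  Multₗ = restrictʳ M.category Lin⊣Mult

  field
    Lin-strongMonoidal : StrongMonoidal M.symmetricMonoidalCategory D.𝒫ₜ-category Linₜ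

  Lin-strong : StrongMonoidalFunctor M.symmetricMonoidalCategory D.𝒫ₜ-category
  Lin-strong = record { functor = Linₜ ; strongMonoidal = Lin-strongMonoidal }

-- The structure of R-relative linear-non-linear coadjunction with prescribed
-- cartesian category M and functors Lin and Mult.
record RelativeLNLCoadjunction {a ℓa ea b ℓb eb m ℓm em : Level}
    (A : SymmetricMonoidalCategory a ℓa ea) {B : Category b ℓb eb}
    (R : Functor B (SymmetricMonoidalCategory.category A))
    (M : CartesianCategory m ℓm em)
    (Lin : StrongMonoidalFunctor (CartesianCategory.symmetricMonoidalCategory M) A)
    (Mult : Functor B (CartesianCategory.category M)) :
    Set (a ⊔ ℓa ⊔ ea ⊔ b ⊔ ℓb ⊔ eb ⊔ m ⊔ ℓm ⊔ em) where
  private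
    module A = SymmetricMonoidalCategory A
    module B = Category B
    module M = CartesianCategory M
    module R = Functor R
    module Lin = StrongMonoidalFunctor Lin
    module Mult = Functor Mult
  field
    ψ : ∀ X N → Inverse (A.homSetoid (Lin.F₀ X) (R.F₀ N)) (M.homSetoid X (Mult.F₀ N))
  module ψ {X} {N} = Inverse (ψ X N)
  field
    ψ-natural-X : ∀ {X X′ N} (f : X′ M.⇒ X) (h : Lin.F₀ X A.⇒ R.F₀ N) →
                  ψ.to (h A.∘ Lin.F₁ f) M.≈ ψ.to h M.∘ f
    ψ-natural-B : ∀ {X N N′} (g : N B.⇒ N′) (h : Lin.F₀ X A.⇒ R.F₀ N) →
                  ψ.to (R.F₁ g A.∘ h) M.≈ Mult.F₁ g M.∘ ψ.to h

{-# OPTIONS --safe #-}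

-- The unit η : A → ⇓ A of the adjunction ⇓ ⊣ id is thunkable and inverse to the
-- counit ω : ⇓ A → A, which is linear because ⇓ A is positive. Since every
-- morphism into a negative N is thunkable, composition with ω and η gives
-- 𝒫ₜ(P, ⇓ N) ≅ 𝒟(P, N), to be composed with 𝒟(Lin X, N) ≅ ℳ(X, Mult N).

module Submission where

open import Level using (Level)
open import Data.Product using (_,_; proj₁; proj₂)
open import Function.Bundles using (Inverse)
import Function.Construct.Composition as Composition
open import Defs

module DownshiftProperties {o ℓ e : Level} (D : Duploid o ℓ e) where
  open Duploid D
  open BareFunctor ⇓
  open Adjunction ⇓⊣id
  open Equiv

  ω : ∀ {A} → F₀ A ⇒ A
  ω = φ.from id

  η : ∀ {A} → A ⇒ F₀ A
  η = φ.to id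

  ω-linear : ∀ {A} → Linear (ω {A})
  ω-linear {A} = ⇓-positive A ω

  -- Yoneda: the right adjoint is the identity, so `φ-naturalˡ` at `h ∘ id` pulls `h` out of `φ`.
  φ≈∘η : ∀ {A B} (h : F₀ A ⇒ B) → φ.to h ≈ h ∘ η
  φ≈∘η h = trans (φ.to-cong (sym identityʳ)) (φ-naturalˡ h id)

  -- Precomposing with `η` is applying `φ`, and `φ-naturalˡ` says that this commutes with
  -- postcomposing by `h`.
  η-thunkable : ∀ {A} → Thunkable (η {A})
  η-thunkable g h = begin
    (h ∘ g) ∘ η   ≈⟨ φ≈∘η (h ∘ g) ⟨
    φ.to (h ∘ g)  ≈⟨ φ-naturalˡ h g ⟩
    h ∘ φ.to g    ≈⟨ ∘-resp-≈ʳ (φ≈∘η g) ⟩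
    h ∘ (g ∘ η)   ∎
    where open HomReasoning

  ω∘η : ∀ {A} → ω ∘ η ≈ id {A}
  ω∘η = trans (sym (φ≈∘η ω)) (φ.strictlyInverseˡ id)

  -- Compared after transposing: `φ` sends both sides to `η`, with no reassociation.
  η∘ω : ∀ {A} → η ∘ ω ≈ id {F₀ A}
  η∘ω = φ-injective (begin
    φ.to (η ∘ ω)  ≈⟨ φ-naturalˡ η ω ⟩
    η ∘ φ.to ω    ≈⟨ ∘-resp-≈ʳ (φ.strictlyInverseˡ id) ⟩
    η ∘ id        ≈⟨ identityʳ ⟩
    η             ∎)
    where open HomReasoning

  -- Both sides have transpose `g`, because `ω` has transpose `id`.
  ω-natural : ∀ {A B} (g : A ⇒ B) → ω ∘ F₁ g ≈ g ∘ ω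
  ω-natural g = φ-injective (begin
    φ.to (ω ∘ F₁ g)  ≈⟨ φ-naturalʳ ω g ⟩
    φ.to ω ∘ g       ≈⟨ ∘-resp-≈ˡ (φ.strictlyInverseˡ id) ⟩
    id ∘ g           ≈⟨ identityˡ ⟩
    g                ≈⟨ identityʳ ⟨
    g ∘ id           ≈⟨ ∘-resp-≈ʳ (φ.strictlyInverseˡ id) ⟨
    g ∘ φ.to ω       ≈⟨ φ-naturalˡ g ω ⟨
    φ.to (g ∘ ω)     ∎)
    where open HomReasoning

  ω∘-inverse : (P : Category.Obj (𝒫ₜ nonAssoc)) (N : Category.Obj (𝒩ₗ nonAssoc)) →
               Inverse (Category.homSetoid (𝒫ₜ nonAssoc) P (Functor.F₀ ⇓ₙ N))
                       (homSetoid (proj₁ P) (proj₁ N))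
  ω∘-inverse (P , P-positive) (N , N-negative) = record
    { to        = λ f → ω ∘ proj₁ f
    ; from      = from
    ; to-cong   = ∘-resp-≈ʳ
    ; from-cong = λ p → ∘-resp-≈ˡ (F-resp-≈ p)
    ; inverse   =
        (λ {g} p → trans (∘-resp-≈ʳ p) (ω∘from g)) ,
        (λ {f} p → trans (∘-resp-≈ˡ (F-resp-≈ p)) (from∘ω f))
    }
    where
    open Category (𝒫ₜ nonAssoc) using () renaming (_⇒_ to _⇒ₜ_; _∘_ to _∘ₜ_)
    open HomReasoning

    -- ⇓ g ∘ η equals η ∘ g, but is a composite in 𝒫ₜ even if N is not positive.
    from : P ⇒ N → (P , P-positive) ⇒ₜ (F₀ N , ⇓-positive N)
    from g = _∘ₜ_ {P , P-positive} {F₀ P , ⇓-positive P} {F₀ N , ⇓-positive N}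
               (F₁ g , F₁-thunkable g (N-negative g)) (η , η-thunkable)

    -- The two reassociations come from linearity of `ω` and thunkability of `η`.
    ω∘from : ∀ g → ω ∘ (F₁ g ∘ η) ≈ g
    ω∘from g = begin
      ω ∘ (F₁ g ∘ η)  ≈⟨ ω-linear η (F₁ g) ⟨
      (ω ∘ F₁ g) ∘ η  ≈⟨ ∘-resp-≈ˡ (ω-natural g) ⟩
      (g ∘ ω) ∘ η     ≈⟨ η-thunkable ω g ⟩
      g ∘ (ω ∘ η)     ≈⟨ ∘-resp-≈ʳ ω∘η ⟩
      g ∘ id          ≈⟨ identityʳ ⟩
      g               ∎

    from∘ω : (f : (P , P-positive) ⇒ₜ (F₀ N , ⇓-positive N)) →
             F₁ (ω ∘ proj₁ f) ∘ η ≈ proj₁ f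
    from∘ω (f , f-thunkable) = begin
      -- Naturality of `η`, read off from the two descriptions of the transpose of `F₁ (ω ∘ f)`;
      -- then thunkability of `f` lets `η` cancel `ω`.
      F₁ (ω ∘ f) ∘ η      ≈⟨ φ≈∘η (F₁ (ω ∘ f)) ⟨
      φ.to (F₁ (ω ∘ f))   ≈⟨ φ∘F₁ (ω ∘ f) ⟩
      η ∘ (ω ∘ f)         ≈⟨ f-thunkable ω η ⟨
      (η ∘ ω) ∘ f         ≈⟨ ∘-resp-≈ˡ η∘ω ⟩
      id ∘ f              ≈⟨ identityˡ ⟩
      f                   ∎

proposition38 : {o ℓ e o′ ℓ′ e′ : Level}
    (D : SymmetricMonoidalDuploid o ℓ e) (M : CartesianCategory o′ ℓ′ e′)
    (L : DirectLNLAdjunction D M) →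
    RelativeLNLCoadjunction
      (SymmetricMonoidalDuploid.𝒫ₜ-category D)
      (SymmetricMonoidalDuploid.⇓ₙ D)
      M
      (DirectLNLAdjunction.Lin-strong L)
      (DirectLNLAdjunction.Multₗ L)
proposition38 D M L = record
  { ψ           = λ X N → Composition.inverse (ω∘-inverse (Linₜ.F₀ X) N) φ
  -- Linearity of `ω` turns `ω ∘ (h ∘ Lin f)` into `(ω ∘ h) ∘ Lin f`, to which naturality of the
  -- adjunction applies.
  ; ψ-natural-X = λ f h → M.Equiv.trans
      (φ.to-cong (D.Equiv.sym (ω-linear (Lin.F₁ f) (proj₁ h))))
      (φ-naturalʳ (ω D.∘ proj₁ h) f)
  ; ψ-natural-B = λ g h → M.Equiv.trans
      (φ.to-cong (ω∘[⇓g∘h] (proj₁ g) (proj₁ h) (proj₂ h)))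
      (φ-naturalˡ (proj₁ g) (ω D.∘ proj₁ h))
  }
  where
  module D = SymmetricMonoidalDuploid D
  module M = CartesianCategory M
  open DirectLNLAdjunction L using (Lin⊣Mult)
  module Lin = BareFunctor (DirectLNLAdjunction.Lin L)
  module Linₜ = Functor (DirectLNLAdjunction.Linₜ L)
  module ⇓ = BareFunctor D.⇓
  open Adjunction Lin⊣Mult
  open DownshiftProperties D.duploid

  -- Naturality in `N` of the bijection given by `ω`: linearity of `ω` brings it next to `⇓ g`, and
  -- thunkability of `h` detaches `g` afterwards.
  ω∘[⇓g∘h] : ∀ {A B C} (g : B D.⇒ C) (h : A D.⇒ ⇓.F₀ B) → D.Thunkable h →
             ω D.∘ (⇓.F₁ g D.∘ h) D.≈ g D.∘ (ω D.∘ h)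
  ω∘[⇓g∘h] g h h-thunkable = begin
    ω D.∘ (⇓.F₁ g D.∘ h)  ≈⟨ ω-linear h (⇓.F₁ g) ⟨
    (ω D.∘ ⇓.F₁ g) D.∘ h  ≈⟨ D.∘-resp-≈ˡ (ω-natural g) ⟩
    (g D.∘ ω) D.∘ h       ≈⟨ h-thunkable ω g ⟩
    g D.∘ (ω D.∘ h)       ∎
    where open D.HomReasoning
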